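{- Let $X$ be an alphabet with $|X|=2$. Let $V$ be a finite set of finite words over $X$ (a system of prohibitions) which defines the two-sided infinite word $W=u^\infty$, where $u$ is a nonempty finite non-periodic word. Then $|u|\le F(|V|)$.
   Context: Words are finite or infinite sequences of letters of $X$; $|u|$ is the length of a finite word $u$; $\Lambda$ is the empty word. A word $v$ is a subword of $w$ if $w=v_1vv_2$ for some words $v_1,v_2$. A nonempty finite word $u$ is periodic if $u=v^m$ for some word $v$ and some $m\ge 2$, and non-periodic otherwise. For a finite word $u$, $u^\infty=\dots uuu\dots$ is the two-sided infinite word with period $u$ (two-sided infinite words are considered up to shift). A (finite or infinite) word $w$ satisfies a finite set of words $V$ if no $v\in V$ is a subword of $w$; $V$ defines the two-sided infinite word $W$ if $W$ is the unique two-sided infinite word satisfying $V$. The Fibonacci numbers are defined by $F(0)=F(1)=1$ and $F(m+1)=F(m)+F(m-1)$. -}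

module Defs where

open import Data.Bool using (Bool; false)
open import Data.Nat using (ℕ; zero; suc; _+_; _≤_)
open import Data.Integer as ℤ using (ℤ; +_; _%ℕ_)
open import Data.Fin using (Fin; toℕ; fromℕ<)
open import Data.Integer.DivMod using (n%ℕd<d)
open import Data.List using (List; []; _∷_; length; lookup; concat; replicate)
open import Data.List.Membership.Propositional using (_∈_)
open import Data.Product using (Σ; ∃; _×_)
open import Relation.Binary.PropositionalEquality using (_≡_)
open import Relation.Nullary using (¬_)

X : Set
X = Bool

Word : Set
Word = List X

-- Two-sided infinite words over X, as maps ℤ → X (considered up to shift).
BiWord : Set
BiWord = ℤ → X

F : ℕ → ℕ
F 0 = 1
F 1 = 1
F (suc (suc m)) = F (suc m) + F m

-- u^∞ : the two-sided infinite word with period u, position i carries u[i mod |u|].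
-- (For u = [] an arbitrary value is returned; it is only used for nonempty u.)
per : Word → BiWord
per [] i = false
per (x ∷ xs) i = lookup (x ∷ xs) (fromℕ< (n%ℕd<d i (suc (length xs))))

OccursAt : BiWord → Word → ℤ → Set
OccursAt W v i = (j : Fin (length v)) → W (i ℤ.+ + toℕ j) ≡ lookup v j

SubwordOf : Word → BiWord → Set
SubwordOf v W = ∃ λ i → OccursAt W v i

Satisfies : BiWord → List Word → Set
Satisfies W V = ∀ v → v ∈ V → ¬ SubwordOf v W

_≈shift_ : BiWord → BiWord → Set
W ≈shift W' = ∃ λ k → ∀ i → W i ≡ W' (i ℤ.+ k)

Defines : List Word → BiWord → Set
Defines V W = Satisfies W V × (∀ W' → Satisfies W' V → W' ≈shift W)

Periodic : Word → Set
Periodic u = Σ Word λ v → Σ ℕ λ m → 2 ≤ m × u ≡ concat (replicate m v)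

{-# OPTIONS --safe #-}
module Submission where

open import Defs
open import Data.Nat using (_≤_)
open import Data.List using (List; []; length)
open import Data.List.Relation.Unary.Unique.Propositional using (Unique)
open import Relation.Binary.PropositionalEquality using (_≢_)
open import Relation.Nullary using (¬_)

open import Data.Bool using (Bool; true; false)
open import Data.Bool.Properties using () renaming (_≟_ to _≟ᵇ_)
open import Data.Empty using (⊥-elim)
open import Data.Fin as Fin using (toℕ; fromℕ<)
open import Data.Fin.Properties using (toℕ<n; toℕ-fromℕ<)
open import Data.Integer as ℤ using (ℤ; _%ℕ_)
open import Data.Integer.DivMod using (n%ℕd<d; a≡a%ℕn+[a/ℕn]*n)
open import Data.Integer.Solver using (module +-*-Solver)
import Data.Integer.Properties as ℤₚ
open import Data.List using (_∷_; _++_; map; filter; lookup; concat; replicate; applyUpTo)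
open import Data.List.Extrema.Nat using (max; xs≤max)
open import Data.List.Membership.Propositional using (_∈_)
open import Data.List.Membership.Propositional.Properties using (∈-map⁺; ∈-filter⁺; ∈-filter⁻)
open import Data.List.Properties using (≡-dec; length-applyUpTo; filter-notAll)
open import Data.List.Relation.Unary.All using () renaming (lookup to All-lookup)
open import Data.List.Relation.Unary.Any as Any using (here; there)
import Data.List.Membership.DecPropositional as DecMembership
open import Data.Nat using (ℕ; zero; suc; _+_; _*_; _∸_; pred; _<_; z≤n; s≤s; NonZero; >-nonZero; _%_; _/_; _≤?_)
open import Data.Nat.DivMod using
  (m≡m%n+[m/n]*n; m%n<n; m<n⇒m%n≡m; [m+n]%n≡m%n; [m+kn]%n≡m%n; m%n%n≡m%n; %-distribˡ-+)
open import Data.Nat.Divisibility using (_∣_; divides; ∣⇒≤; ∣m+n∣m⇒∣n)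
open import Data.Nat.GCD using (module GCD; module Bézout)
open import Data.Nat.Properties
open import Data.Nat.Tactic.RingSolver using (solve-∀)
open import Data.Product using (∃; _×_; _,_; proj₁; proj₂)
open import Data.Sum using (_⊎_; inj₁; inj₂)
open import Function using (_∘_)
open import Relation.Binary using (tri<; tri≈; tri>)
open import Relation.Binary.PropositionalEquality
  using (_≡_; refl; sym; trans; cong; cong₂; subst; subst₂; module ≡-Reasoning)
open import Relation.Nullary using (Dec; yes; no; contradiction)
open import Relation.Nullary.Decidable using (map′; ¬?)
open import Relation.Binary.Definitions using (DecidableEquality)

-- The bound holds for the least period c of any periodic word satisfying V, and is proved
-- by induction on |V|.  Let U attain c.  We may assume that every v ∈ V is a minimal
-- forbidden word of U; conversely every minimal forbidden word xwy of U lies in V, since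
-- otherwise the factor of U running from an occurrence of wy to one of xw, closed up along
-- w, would satisfy V and have a period less than c.  If c > 1, let w be a longest word
-- occurring at two different places of a period.  It cuts the period into two loops, of
-- lengths α ≤ β, and closing each loop along w creates exactly one forbidden factor, say
-- m and m′, which therefore belong to V.  A periodic word avoiding V ∖ {m, m′} can leave the
-- course of U only at m or m′, so if m occurs in it then its period is at least α, and if
-- m′ occurs then at least β.  Hence V ∖ {m′} and V ∖ {m, m′} have least periods β and α, and
-- c = α + β ≤ F(|V| − 1) + F(|V| − 2).

-- Sequences on `ℕ` and agreement of their windows.

Seq : Set
Seq = ℕ → X

Period : ℕ → Seq → Set
Period d P = ∀ n → P (n + d) ≡ P n

-- A record rather than a bare function type, so that `P`, `s`, `Q` and `t` can be recovered by
-- unification.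
record Agree (k : ℕ) (P : Seq) (s : ℕ) (Q : Seq) (t : ℕ) : Set where
  constructor agree
  infixl 8 _at_
  field _at_ : ∀ {r} → r < k → P (s + r) ≡ Q (t + r)

open Agree

Agree-sym : ∀ {k P s Q t} → Agree k P s Q t → Agree k Q t P s
Agree-sym a = agree λ r<k → sym (a at r<k)

Agree-trans : ∀ {k P s Q t R u} → Agree k P s Q t → Agree k Q t R u → Agree k P s R u
Agree-trans a b = agree λ r<k → trans (a at r<k) (b at r<k)

Agree-take : ∀ {k m P s Q t} → m ≤ k → Agree k P s Q t → Agree m P s Q t
Agree-take m≤k a = agree λ r<m → a at <-≤-trans r<m m≤k

Agree-sub : ∀ {k m P s Q t} o → o + m ≤ k → Agree k P s Q t → Agree m P (s + o) Q (t + o)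
Agree-sub {P = P} {s} {Q} {t} o o+m≤k a = agree λ {r} r<m → begin
  P (s + o + r)   ≡⟨ cong P (+-assoc s o r) ⟩
  P (s + (o + r)) ≡⟨ a at <-≤-trans (+-monoʳ-< o r<m) o+m≤k ⟩
  Q (t + (o + r)) ≡⟨ cong Q (+-assoc t o r) ⟨
  Q (t + o + r)   ∎
  where open ≡-Reasoning

Agree-tail : ∀ {k P s Q t} → Agree (suc k) P s Q t → Agree k P (suc s) Q (suc t)
Agree-tail {k} {P} {s} {Q} {t} a = agree λ {r} r<k → begin
  P (suc s + r) ≡⟨ cong P (+-suc s r) ⟨
  P (s + suc r) ≡⟨ a at s≤s r<k ⟩
  Q (t + suc r) ≡⟨ cong Q (+-suc t r) ⟩
  Q (suc t + r) ∎
  where open ≡-Reasoning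

Agree-init : ∀ {k P s Q t} → Agree (suc k) P s Q t → Agree k P s Q t
Agree-init = Agree-take (n≤1+n _)

Agree-snoc : ∀ {k P s Q t} → Agree k P s Q t → P (s + k) ≡ Q (t + k) → Agree (suc k) P s Q t
Agree-snoc {k} {P} {s} {Q} {t} a e = agree go
  where
  go : ∀ {r} → r < suc k → P (s + r) ≡ Q (t + r)
  go r<1+k with m≤n⇒m<n∨m≡n (≤-pred r<1+k)
  ... | inj₁ r<k  = a at r<k
  ... | inj₂ refl = e

Agree-join : ∀ {k P s Q t} → Agree (1 + k) P s Q t → Agree (1 + k) P (suc s) Q (suc t) →
  Agree (2 + k) P s Q t
Agree-join {k} {P} {s} {Q} {t} a b =
  Agree-snoc a (trans (cong P (+-suc s k)) (trans (b at ≤-refl) (cong Q (sym (+-suc t k)))))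

agree? : ∀ k P s Q t → Dec (Agree k P s Q t)
agree? k P s Q t with allUpTo? (λ r → P (s + r) ≟ᵇ Q (t + r)) k
... | yes f = yes (agree f)
... | no ¬f = no λ a → ¬f (a at_)

-- The default `false` is never consulted: `nth v` is only compared below `length v`.
nth : Word → Seq
nth []      _       = false
nth (x ∷ v) zero    = x
nth (x ∷ v) (suc r) = nth v r

win : Seq → ℕ → ℕ → Word
win Q s k = applyUpTo (λ r → Q (s + r)) k

nth-applyUpTo : ∀ (f : Seq) k r → r < k → nth (applyUpTo f k) r ≡ f r
nth-applyUpTo f (suc k) zero    _         = refl
nth-applyUpTo f (suc k) (suc r) (s≤s r<k) = nth-applyUpTo (f ∘ suc) k r r<k

nth-win : ∀ Q s k → Agree k (nth (win Q s k)) 0 Q s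
nth-win Q s k = agree (nth-applyUpTo (λ r → Q (s + r)) k _)

length-win : ∀ Q s k → length (win Q s k) ≡ k
length-win Q s = length-applyUpTo (λ r → Q (s + r))

word-≡ : ∀ v w → length v ≡ length w → Agree (length v) (nth v) 0 (nth w) 0 → v ≡ w
word-≡ []      []      _ _ = refl
word-≡ (x ∷ v) (y ∷ w) e a =
  cong₂ _∷_ (a at s≤s z≤n) (word-≡ v w (suc-injective e) (agree λ r<k → a at s≤s r<k))

≡-win : ∀ {k} v Q s → length v ≡ k → Agree k (nth v) 0 Q s → v ≡ win Q s k
≡-win v Q s refl a = word-≡ v _ (sym (length-win Q s _)) (Agree-trans a (Agree-sym (nth-win Q s _)))

win-cong : ∀ {k P s Q t} → Agree k P s Q t → win P s k ≡ win Q t k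
win-cong {k} {P} {s} {Q} {t} a = ≡-win _ Q t (length-win P s k) (Agree-trans (nth-win P s k) a)

win-agree : ∀ {k P s Q t} → win P s k ≡ win Q t k → Agree k P s Q t
win-agree {k} {P} {s} {Q} {t} e =
  Agree-trans (Agree-sym (nth-win P s k)) (subst (λ w → Agree k (nth w) 0 Q t) (sym e) (nth-win Q t k))

OccAt : Seq → Word → ℕ → Set
OccAt P v s = Agree (length v) P s (nth v) 0

occ-win : ∀ P s k → OccAt P (win P s k) s
occ-win P s k = Agree-take (≤-reflexive (length-win P s k)) (Agree-sym (nth-win P s k))

occ-agree : ∀ {k P t Q s} → OccAt P (win Q s k) t → Agree k P t Q s
occ-agree {k} {Q = Q} {s} a = Agree-trans (Agree-take (≤-reflexive (sym (length-win Q s k))) a) (nth-win Q s k)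

Sat : Seq → List Word → Set
Sat P V = ∀ {v} → v ∈ V → ∀ s → ¬ OccAt P v s

In : ℕ → Seq → Seq → ℕ → Set
In k U Q t = ∃ λ x → Agree k U x Q t

-- Congruence modulo a period

module _ (c : ℕ) .{{_ : NonZero c}} where

  %-shift : ∀ x e → 0 < e → e < c → (x + e) % c ≢ x % c
  %-shift x e 0<e e<c eq = <⇒≱ e<c (∣⇒≤ {{>-nonZero 0<e}} c∣e)
    where
    open ≡-Reasoning
    q′ = (x + e) / c
    q  = x / c
    eq′ : q * c + e ≡ q′ * c
    eq′ = +-cancelˡ-≡ (x % c) _ _ (begin
      x % c + (q * c + e)   ≡⟨ +-assoc (x % c) (q * c) e ⟨
      x % c + q * c + e     ≡⟨ cong (_+ e) (m≡m%n+[m/n]*n x c) ⟨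
      x + e                 ≡⟨ m≡m%n+[m/n]*n (x + e) c ⟩
      (x + e) % c + q′ * c  ≡⟨ cong (_+ q′ * c) eq ⟩
      x % c + q′ * c        ∎)
    c∣e : c ∣ e
    c∣e = ∣m+n∣m⇒∣n (divides q′ eq′) (divides q refl)

  %-+-cong : ∀ {x y} r → x % c ≡ y % c → (x + r) % c ≡ (y + r) % c
  %-+-cong {x} {y} r e = begin
    (x + r) % c             ≡⟨ %-distribˡ-+ x r c ⟩
    (x % c + r % c) % c     ≡⟨ cong (λ z → (z + r % c) % c) e ⟩
    (y % c + r % c) % c     ≡⟨ %-distribˡ-+ y r c ⟨
    (y + r) % c             ∎
    where open ≡-Reasoning

  %-suc-cong : ∀ {x y} → x % c ≡ y % c → suc x % c ≡ suc y % c
  %-suc-cong {x} {y} e = trans (cong (_% c) (+-comm 1 x)) (trans (%-+-cong 1 e) (cong (_% c) (+-comm y 1)))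

  %-suc-cancel : ∀ {x y} → suc x % c ≡ suc y % c → x % c ≡ y % c
  %-suc-cancel {x} {y} e = begin
    x % c                    ≡⟨ [m+n]%n≡m%n x c ⟨
    (x + c) % c              ≡⟨ cong (_% c) (eq x) ⟨
    (suc x + pred c) % c     ≡⟨ %-+-cong (pred c) e ⟩
    (suc y + pred c) % c     ≡⟨ cong (_% c) (eq y) ⟩
    (y + c) % c              ≡⟨ [m+n]%n≡m%n y c ⟩
    y % c                    ∎
    where
    open ≡-Reasoning
    eq : ∀ z → suc z + pred c ≡ z + c
    eq z = trans (sym (+-suc z (pred c))) (cong (z +_) (suc-pred c))

  -- The distance from `y` forward to `x` is the residue of their difference, with `c ∸ y % c`
  -- standing in for the negative of `y`. It is nonzero because the residues differ.
  %-gap : ∀ x y → x % c ≢ y % c → ∃ λ e → suc e < c × (y + suc e) % c ≡ x % c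
  %-gap x y x≢y = go (m%n<n (x + (c ∸ y % c)) c) eq
    where
    eq : (y + (x + (c ∸ y % c)) % c) % c ≡ x % c
    eq = begin
      (y + (x + (c ∸ y % c)) % c) % c  ≡⟨ cong (_% c) (+-comm y _) ⟩
      ((x + (c ∸ y % c)) % c + y) % c  ≡⟨ %-+-cong y (m%n%n≡m%n (x + (c ∸ y % c)) c) ⟩
      (x + (c ∸ y % c) + y) % c        ≡⟨ cong (_% c) (+-comm (x + (c ∸ y % c)) y) ⟩
      (y + (x + (c ∸ y % c))) % c      ≡⟨ %-+-cong (x + (c ∸ y % c)) (m%n%n≡m%n y c) ⟨
      (y % c + (x + (c ∸ y % c))) % c  ≡⟨ cong (_% c) (+-comm (y % c) _) ⟩
      (x + (c ∸ y % c) + y % c) % c    ≡⟨ cong (_% c) (+-assoc x (c ∸ y % c) (y % c)) ⟩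
      (x + (c ∸ y % c + y % c)) % c    ≡⟨ cong (λ z → (x + z) % c) (m∸n+n≡m (<⇒≤ (m%n<n y c))) ⟩
      (x + c) % c                      ≡⟨ [m+n]%n≡m%n x c ⟩
      x % c                            ∎
      where open ≡-Reasoning
    go : ∀ {d} → d < c → (y + d) % c ≡ x % c → ∃ λ e → suc e < c × (y + suc e) % c ≡ x % c
    go {zero}  _   e = contradiction (trans (sym e) (cong (_% c) (+-identityʳ y))) x≢y
    go {suc d} d<c e = d , d<c , e

  period-* : ∀ {P} → Period c P → ∀ q n → P (n + q * c) ≡ P n
  period-* {P} per zero    n = cong P (+-identityʳ n)
  period-* {P} per (suc q) n = begin
    P (n + (c + q * c)) ≡⟨ cong P (+-assoc n c (q * c)) ⟨
    P (n + c + q * c)   ≡⟨ period-* per q (n + c) ⟩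
    P (n + c)           ≡⟨ per n ⟩
    P n                 ∎
    where open ≡-Reasoning

  period-% : ∀ {P} → Period c P → ∀ n → P (n % c) ≡ P n
  period-% {P} per n = begin
    P (n % c)               ≡⟨ period-* per (n / c) (n % c) ⟨
    P (n % c + n / c * c)   ≡⟨ cong P (m≡m%n+[m/n]*n n c) ⟨
    P n                     ∎
    where open ≡-Reasoning

  period-cong : ∀ {P} → Period c P → ∀ {x y} → x % c ≡ y % c → P x ≡ P y
  period-cong {P} per {x} {y} e =
    trans (sym (period-% per x)) (trans (cong P e) (period-% per y))

  agree-cong : ∀ {P} → Period c P → ∀ {x y} → x % c ≡ y % c → ∀ k → Agree k P x P y
  agree-cong per e k = agree λ {r} _ → period-cong per (%-+-cong r e)

  -- By periodicity an occurrence can be moved to a start below `c`, so a bounded search decides.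
  in? : ∀ {U} → Period c U → ∀ k Q t → Dec (In k U Q t)
  in? {U} per k Q t = map′
    (λ (x , _ , a) → x , a)
    (λ (x , a) → x % c , m%n<n x c , Agree-trans (agree-cong per (m%n%n≡m%n x c) k) a)
    (anyUpTo? (λ x → agree? k U x Q t) c)

-- Gluing

glue : Seq → ℕ → (d : ℕ) .{{_ : NonZero d}} → Seq
glue U s d n = U (s + n % d)

module _ {U : Seq} {s d ℓ : ℕ} .{{_ : NonZero d}} (a : Agree ℓ U s U (s + d)) where

  glue-period : Period d (glue U s d)
  glue-period n = cong (λ r → U (s + r)) ([m+n]%n≡m%n n d)

  private
    unwind : ∀ q r → r + q * d < d + ℓ → U (s + (r + q * d)) ≡ U (s + r)
    unwind zero    r _  = cong (λ z → U (s + z)) (+-identityʳ r)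
    unwind (suc q) r lt = begin
      U (s + (r + (d + q * d))) ≡⟨ cong U (eq s r d (q * d)) ⟩
      U (s + d + (r + q * d))   ≡⟨ a at lt′ ⟨
      U (s + (r + q * d))       ≡⟨ unwind q r (<-≤-trans lt′ (m≤n+m ℓ d)) ⟩
      U (s + r)                 ∎
      where
      open ≡-Reasoning
      eq : ∀ s r d x → s + (r + (d + x)) ≡ s + d + (r + x)
      eq = solve-∀
      eq′ : ∀ r d x → r + (d + x) ≡ d + (r + x)
      eq′ = solve-∀
      lt′ : r + q * d < ℓ
      lt′ = +-cancelˡ-< d _ _ (subst (_< d + ℓ) (eq′ r d (q * d)) lt)

  -- The overlap `a` gives the factor of `U` of length `d + ℓ` at `s` the period `d` (`unwind`), so
  -- the glued word shows this whole factor at each multiple of `d`.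
  glue-agree : ∀ q → Agree (d + ℓ) (glue U s d) (q * d) U s
  glue-agree q = agree λ {r} r<d+ℓ → begin
    U (s + (q * d + r) % d)       ≡⟨ cong (λ z → U (s + z % d)) (+-comm (q * d) r) ⟩
    U (s + (r + q * d) % d)       ≡⟨ cong (λ z → U (s + z)) ([m+kn]%n≡m%n r q d) ⟩
    U (s + r % d)                 ≡⟨ unwind (r / d) (r % d) (subst (_< d + ℓ) (m≡m%n+[m/n]*n r d) r<d+ℓ) ⟨
    U (s + (r % d + r / d * d))   ≡⟨ cong (λ z → U (s + z)) (m≡m%n+[m/n]*n r d) ⟨
    U (s + r)                     ∎
    where open ≡-Reasoning

module _ {U : Seq} {s e ℓ : ℕ} (a : Agree ℓ U s U (s + suc e)) where

  private
    d = suc e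
    G = glue U s d

  -- The windows of the glued word that need not be factors of U contain the
  -- one of length 2 + ℓ at position e, called its seam.
  seam-init : Agree (1 + ℓ) G e U (s + e)
  seam-init = Agree-sub e (≤-reflexive (+-suc e ℓ)) (glue-agree a 0)

  seam-tail : Agree (1 + ℓ) G (suc e) U s
  seam-tail = subst (λ z → Agree (1 + ℓ) G z U s) (+-identityʳ d)
    (Agree-take (s≤s (m≤n+m ℓ e)) (glue-agree a 1))

  -- A window that does not fit into the `d + ℓ` letters covered by `glue-agree` reaches position
  -- `d + ℓ` of its block, so it contains the seam, `e ∸ t % d` letters after its start.
  glue-factor : ∀ t k → In k U G t ⊎ ∃ λ o → o + (2 + ℓ) ≤ k × Agree (2 + ℓ) G (t + o) G e
  glue-factor t k with t % d + k ≤? d + ℓ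
  ... | yes le = inj₁ (s + t % d , Agree-sym (subst (λ z → Agree k G z U (s + t % d)) eq
                   (Agree-sub (t % d) le (glue-agree a (t / d)))))
    where
    eq : t / d * d + t % d ≡ t
    eq = trans (+-comm (t / d * d) (t % d)) (sym (m≡m%n+[m/n]*n t d))
  ... | no nle = inj₂ (o , o-le , agree-cong d (glue-period a) cong′ (2 + ℓ))
    where
    r = t % d
    o = e ∸ r
    r≤e : r ≤ e
    r≤e = ≤-pred (m%n<n t d)
    o-le : o + (2 + ℓ) ≤ k
    o-le = +-cancelˡ-≤ r _ _ (begin
      r + (o + (2 + ℓ)) ≡⟨ +-assoc r o (2 + ℓ) ⟨
      r + o + (2 + ℓ)   ≡⟨ cong (_+ (2 + ℓ)) (m+[n∸m]≡n r≤e) ⟩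
      e + (2 + ℓ)       ≡⟨ +-suc e (suc ℓ) ⟩
      suc (e + suc ℓ)   ≡⟨ cong suc (+-suc e ℓ) ⟩
      suc (d + ℓ)       ≤⟨ ≰⇒> nle ⟩
      r + k             ∎)
      where open ≤-Reasoning
    cong′ : (t + o) % d ≡ e % d
    cong′ = begin
      (t + o) % d     ≡⟨ %-+-cong d {t} {r} o (sym (m%n%n≡m%n t d)) ⟩
      (r + o) % d     ≡⟨ cong (_% d) (m+[n∸m]≡n r≤e) ⟩
      e % d           ∎
      where open ≡-Reasoning

-- Minimal forbidden words

-- Only the proper factors are constrained here; that `v` itself does not occur in `U` comes from
-- `Sat`.
Minimal : Seq → Word → Set
Minimal U v = ∃ λ k → length v ≡ suc k × In k U (nth v) 0 × In k U (nth v) 1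

In-sub : ∀ {k m U Q t} o → o + m ≤ k → In k U Q t → In m U Q (t + o)
In-sub o le (x , a) = x + o , Agree-sub o le a

In-cong : ∀ {k U P s Q t} → Agree k P s Q t → In k U P s → In k U Q t
In-cong a (x , b) = x , Agree-trans b a

In-letter : ∀ {U x Q t} → U x ≡ Q t → In 1 U Q t
In-letter {U} {x} {Q} {t} eq =
  x , agree λ { (s≤s z≤n) → trans (cong U (+-identityʳ x)) (trans eq (cong Q (sym (+-identityʳ t)))) }

strict-factor : ∀ {U v} → Minimal U v → ∀ o m → o + m ≤ length v → m < length v → In m U (nth v) o
strict-factor (k , e , i , _) zero    m _  lt = In-sub 0 (≤-pred (subst (m <_) e lt)) i
strict-factor (k , e , _ , i) (suc o) m le _  = In-sub o (≤-pred (subst (suc o + m ≤_) e le)) i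

-- Drop the first letter, or else the last, as long as the rest is still not a factor of `U`. The
-- empty window is a factor, so this stops at a nonempty word.
minimal-factor : ∀ {c U} .{{_ : NonZero c}} → Period c U → ∀ k Q s → ¬ In k U Q s →
  ∃ λ w → Minimal U w × (∀ x → ¬ OccAt U w x) × (∀ {P t} → Agree k P t Q s → ∃ (OccAt P w))
minimal-factor per zero    Q s ∉U = contradiction (0 , agree λ ()) ∉U
minimal-factor {c} per (suc k) Q s ∉U with in? c per k Q (suc s)
... | no ∉U′ = let w , mini , avoid , occ = minimal-factor per k Q (suc s) ∉U′ in
  w , mini , avoid , λ a → occ (Agree-tail a)
... | yes tail with in? c per k Q s
...   | no ∉U′ = let w , mini , avoid , occ = minimal-factor per k Q s ∉U′ in
  w , mini , avoid , λ a → occ (Agree-init a)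
...   | yes init = win Q s (suc k)
  , (k , length-win Q s (suc k) , In-cong (Agree-init Q~w) init , In-cong (Agree-tail Q~w) tail)
  , (λ x a → ∉U (x , occ-agree a))
  , λ {P} {t} a → t , subst (λ w → OccAt P w t) (win-cong a) (occ-win P t (suc k))
  where
  Q~w : Agree (suc k) Q s (nth (win Q s (suc k))) 0
  Q~w = Agree-sym (nth-win Q s (suc k))

-- Each prohibition is replaced by a minimal forbidden factor of itself. The new system is at least
-- as strong and `U` still satisfies it, so `c` stays the least period.
minimise : ∀ {c U} .{{_ : NonZero c}} → Period c U → ∀ V → Sat U V →
  ∃ λ V̂ → length V̂ ≡ length V × Sat U V̂ × (∀ {v} → v ∈ V̂ → Minimal U v) × (∀ {P} → Sat P V̂ → Sat P V)
minimise per []      sat = [] , refl , (λ ()) , (λ ()) , λ _ ()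
minimise per (v ∷ V) sat
  with V̂ , len , sat′ , mini , reflects ← minimise per V (sat ∘ there)
     | w , mini′ , avoid , occ ← minimal-factor per (length v) (nth v) 0 (λ (x , a) → sat (here refl) x a)
  = w ∷ V̂ , cong suc len
  , (λ { (here refl) → avoid ; (there p) → sat′ p })
  , (λ { (here refl) → mini′ ; (there p) → mini p })
  , λ satP → λ { (here refl) t a → let x , b = occ a in satP (here refl) x b
               ; (there p) → reflects (satP ∘ there) p }

-- Least periods and the prohibitions they force.

-- `least` ranges over all periodic words satisfying `V`, not only over the periods of `U`. Unlike
-- uniqueness of the word, this property passes to the systems with seams removed, with new `U` and
-- `c`.
record Least (V : List Word) (U : Seq) (c : ℕ) : Set where
  field
    period : Period c U
    sat    : Sat U V
    least  : ∀ {d P} .{{_ : NonZero d}} → d < c → Period d P → ¬ Sat P V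

open Least

_≟ʷ_ : DecidableEquality Word
_≟ʷ_ = ≡-dec _≟ᵇ_

open DecMembership _≟ʷ_ using (_∈?_)

same-length : ∀ {k m P s Q t} → win P s k ≡ win Q t m → k ≡ m
same-length {k} {m} {P} {s} {Q} {t} eq =
  trans (sym (length-win P s k)) (trans (cong length eq) (length-win Q t m))

-- All copies go, as `minimise` may send several prohibitions to one word.
_∖_ : List Word → Word → List Word
V ∖ m = filter (λ v → ¬? (v ≟ʷ m)) V

length-∖ : ∀ {V m} → m ∈ V → length (V ∖ m) < length V
length-∖ {V} {m} m∈V = filter-notAll (λ v → ¬? (v ≟ʷ m)) V (Any.map (λ { refl n → n refl }) m∈V)

∈-∖⁺ : ∀ {V v m} → v ∈ V → v ≢ m → v ∈ V ∖ m
∈-∖⁺ {m = m} = ∈-filter⁺ (λ v → ¬? (v ≟ʷ m))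

∈-∖⁻ : ∀ {V v m} → v ∈ V ∖ m → v ∈ V × v ≢ m
∈-∖⁻ {m = m} = ∈-filter⁻ (λ v → ¬? (v ≟ʷ m))

≢∧≢⇒≡ : {x y z : Bool} → y ≢ z → x ≢ y → x ≡ z
≢∧≢⇒≡ {false} {false} {z}     _   x≢y = contradiction refl x≢y
≢∧≢⇒≡ {false} {true}  {false} _   _   = refl
≢∧≢⇒≡ {false} {true}  {true}  y≢z _   = contradiction refl y≢z
≢∧≢⇒≡ {true}  {true}  {z}     _   x≢y = contradiction refl x≢y
≢∧≢⇒≡ {true}  {false} {true}  _   _   = refl
≢∧≢⇒≡ {true}  {false} {false} y≢z _   = contradiction refl y≢z

-- If a word `w` of length `ℓ` occurs in `U` at `s` and at `s + suc e`, this is `xwy`, with `x` the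
-- letter before the second `w` and `y` the letter after the first.
seam : Seq → ℕ → ℕ → ℕ → Word
seam U s e ℓ = win (glue U s (suc e)) e (2 + ℓ)

last-true : ∀ {P : ℕ → Set} → (∀ n → Dec (P n)) → P 0 → ∀ n → ¬ P n → ∃ λ m → P m × ¬ P (suc m)
last-true P? p₀ zero    ¬p = contradiction p₀ ¬p
last-true P? p₀ (suc n) ¬p with P? n
... | yes p = n , p , ¬p
... | no ¬q = last-true P? p₀ n ¬q

module _ {V : List Word} {U : Seq} {c : ℕ} .{{_ : NonZero c}}
         (L : Least V U c) (minimal : ∀ {v} → v ∈ V → Minimal U v) where

  -- An occurrence of `v` that is not a factor of `U` covers the seam. If `v` is longer than the
  -- seam, its minimality makes the seam a factor of `U`; otherwise `v` is the seam.
  glue-avoids : ∀ {s e ℓ} → Agree ℓ U s U (s + suc e) → ¬ In (2 + ℓ) U (glue U s (suc e)) e →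
    ∀ {v} → v ∈ V → v ≢ seam U s e ℓ → ∀ t → ¬ OccAt (glue U s (suc e)) v t
  glue-avoids {s} {e} {ℓ} a ∉U {v} v∈V v≢seam t occ with glue-factor a t (length v)
  ... | inj₁ (x , b) = sat L v∈V x (Agree-trans b occ)
  ... | inj₂ (o , le , b) with m≤n⇒m<n∨m≡n (m+n≤o⇒n≤o o le)
  ...   | inj₁ lt = ∉U (In-cong (Agree-trans (Agree-sym (Agree-sub o le occ)) b) (strict-factor {v = v} (minimal v∈V) o _ le lt))
  ...   | inj₂ eq = v≢seam (≡-win v G e (sym eq) (Agree-trans (Agree-sym occ′) b′))
    where
    G = glue U s (suc e)
    occ′ : Agree (2 + ℓ) G t (nth v) 0
    occ′ = Agree-take (≤-reflexive eq) occ
    o≡0 : o ≡ 0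
    o≡0 = m+n≤n⇒m≡0 (subst (o + (2 + ℓ) ≤_) (sym eq) le)
      where
      m+n≤n⇒m≡0 : ∀ {m n} → m + n ≤ n → m ≡ 0
      m+n≤n⇒m≡0 {m} {n} le = n≤0⇒n≡0 (+-cancelʳ-≤ n m 0 le)
    b′ : Agree (2 + ℓ) G t G e
    b′ = subst (λ z → Agree (2 + ℓ) G z G e) (trans (cong (t +_) o≡0) (+-identityʳ t)) b

  -- Otherwise the glued word would satisfy `V` with a period less than `c`.
  seam-forbidden : ∀ {s e ℓ} → suc e < c → Agree ℓ U s U (s + suc e) →
    ¬ In (2 + ℓ) U (glue U s (suc e)) e → seam U s e ℓ ∈ V
  seam-forbidden {s} {e} {ℓ} lt a ∉U with seam U s e ℓ ∈? V
  ... | yes m∈V = m∈V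
  ... | no  m∉V = ⊥-elim
    (least L lt (glue-period a) (λ v∈V → glue-avoids a ∉U v∈V λ { refl → m∉V v∈V }))

  -- The window is realised as a seam. Its two shortenings share a word of length `k`, and `U` is
  -- closed up along it, from its occurrence at `y` forward to the one at `suc x`.
  minimal-forbidden : ∀ {Q t k} → In (1 + k) U Q t → In (1 + k) U Q (suc t) → ¬ In (2 + k) U Q t →
    win Q t (2 + k) ∈ V
  minimal-forbidden {Q} {t} {k} (x , a) (y , b) ∉U =
    subst (_∈ V) (win-cong G~Q) (seam-forbidden lt a′ (∉U ∘ In-cong G~Q))
    where
    -- Congruent positions would join the two occurrences into one of the whole window.
    sx≢y : suc x % c ≢ y % c
    sx≢y eq = ∉U (x , Agree-join a (Agree-trans (agree-cong c (period L) eq (1 + k)) b))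
    gap = %-gap c (suc x) y sx≢y
    e = proj₁ gap
    lt = proj₁ (proj₂ gap)
    G = glue U y (suc e)
    a′ : Agree k U y U (y + suc e)
    a′ = Agree-trans (Agree-init b) (Agree-trans (Agree-sym (Agree-tail a))
           (agree-cong c (period L) (sym (proj₂ (proj₂ gap))) k))
    y+e≡x : (y + e) % c ≡ x % c
    y+e≡x = %-suc-cancel c (trans (cong (_% c) (sym (+-suc y e))) (proj₂ (proj₂ gap)))
    G~Q : Agree (2 + k) G e Q t
    G~Q = Agree-join
      (Agree-trans (seam-init a′) (Agree-trans (agree-cong c (period L) y+e≡x (1 + k)) a))
      (Agree-trans (seam-tail a′) b)

  -- Two occurrences, at i and j, of a longest repeated word (of length ℓ) cut a period
  -- of U into loops of lengths suc e and suc f.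
  record Loops (ℓ i e j f : ℕ) : Set where
    field
      length-eq : suc e + suc f ≡ c
      i→j       : (i + suc e) % c ≡ j % c
      j→i       : (j + suc f) % c ≡ i % c
      shared   : Agree ℓ U i U j
      injective : ∀ {x y} → Agree (1 + ℓ) U x U y → x % c ≡ y % c

  swap : ∀ {ℓ i e j f} → Loops ℓ i e j f → Loops ℓ j f i e
  swap {e = e} {f = f} S = record
    { length-eq = trans (+-comm (suc f) (suc e)) length-eq
    ; i→j = j→i ; j→i = i→j ; shared = Agree-sym shared ; injective = injective }
    where open Loops S

  module _ {ℓ i e j f} (S : Loops ℓ i e j f) where

    open Loops S

    loop-< : suc e < c
    loop-< = subst (suc e <_) length-eq (m<m+n (suc e) (s≤s z≤n))

    loop-step : ∀ r → r ≤ e → (i + suc r) % c ≢ i % c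
    loop-step r r≤e = %-shift c i (suc r) (s≤s z≤n) (≤-<-trans (s≤s r≤e) loop-<)

    loop-≢ : i % c ≢ j % c
    loop-≢ eq = loop-step e ≤-refl (trans i→j (sym eq))

    closes : Agree ℓ U i U (i + suc e)
    closes = Agree-trans shared (agree-cong c (period L) (sym i→j) ℓ)

    -- By `injective`, the seam without its last letter occurs only at `i + e`, and without its
    -- first letter only at `i`; these would have to be adjacent.
    seam-∉ : ¬ In (2 + ℓ) U (glue U i (suc e)) e
    seam-∉ (x , a) = loop-step e ≤-refl (begin
      (i + suc e) % c     ≡⟨ cong (_% c) (+-suc i e) ⟩
      suc (i + e) % c     ≡⟨ %-suc-cong c (injective (Agree-trans (Agree-init a) (seam-init closes))) ⟨
      suc x % c           ≡⟨ injective (Agree-trans (Agree-tail a) (seam-tail closes)) ⟩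
      i % c               ∎)
      where open ≡-Reasoning

    seam-∈ : seam U i e ℓ ∈ V
    seam-∈ = seam-forbidden loop-< closes seam-∉

    loop-avoids : ∀ {v} → v ∈ V → v ≢ seam U i e ℓ → ∀ t → ¬ OccAt (glue U i (suc e)) v t
    loop-avoids = glue-avoids closes seam-∉

    loop-period : Period (suc e) (glue U i (suc e))
    loop-period = glue-period closes

    seam-agree : ∀ {P s} → Agree (2 + ℓ) P s (glue U i (suc e)) e →
      Agree (1 + ℓ) P s U (i + e) × Agree (1 + ℓ) P (suc s) U i
    seam-agree a = Agree-trans (Agree-init a) (seam-init closes) , Agree-trans (Agree-tail a) (seam-tail closes)

    -- This is where `|X| = 2` enters: the letters of `U` at `i + ℓ` and `j + ℓ` differ, as
    -- otherwise `injective` would identify `i` with `j`, so they exhaust the alphabet.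
    letter : ∀ Q t → In 1 U Q t
    letter Q t with Q t ≟ᵇ U (i + ℓ)
    ... | yes eq = In-letter (sym eq)
    ... | no ne  = In-letter (sym (≢∧≢⇒≡ (λ eq → loop-≢ (injective (Agree-snoc shared eq))) ne))

  -- Without their first letters the seams are the windows of `U` at `i` and `j`, which `injective`
  -- tells apart.
  seams-≢ : ∀ {ℓ i e j f} → Loops ℓ i e j f → seam U i e ℓ ≢ seam U j f ℓ
  seams-≢ {ℓ} {i} {e} {j} {f} S eq = loop-≢ S (injective (Agree-trans
    (Agree-sym (proj₂ (seam-agree S {glue U i (suc e)} {e} (agree λ _ → refl))))
    (proj₂ (seam-agree (swap S) (win-agree {s = e} {t = f} eq)))))
    where open Loops S

  -- Words in which only the two seams may occur among the prohibitions.

  AvoidsOthers : (ℓ i e j f : ℕ) → Seq → Set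
  AvoidsOthers ℓ i e j f P =
    ∀ {v} → v ∈ V → v ≢ seam U i e ℓ → v ≢ seam U j f ℓ → ∀ s → ¬ OccAt P v s

  module _ {ℓ i e j f P} (S : Loops ℓ i e j f) (others : AvoidsOthers ℓ i e j f P) where

    open Loops S

    private
      mX = seam U i e ℓ
      mY = seam U j f ℓ

      same-length₂ : ∀ {k s} i e → win P s (2 + k) ≡ seam U i e ℓ → k ≡ ℓ
      same-length₂ {s = s} i e eq = suc-injective (suc-injective
        (same-length {P = P} {s} {glue U i (suc e)} {e} eq))

      window : ∀ {k s} i e → win P s (2 + k) ≡ seam U i e ℓ → Agree (2 + ℓ) P s (glue U i (suc e)) e
      window i e eq with refl ← same-length₂ i e eq = win-agree eq

    -- If the window is not a factor of `U`, it lies in `V` by `minimal-forbidden`, so it is one of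
    -- the seams.
    extend : ∀ k s → In (1 + k) U P s → In (1 + k) U P (suc s) →
      In (2 + k) U P s ⊎ k ≡ ℓ × (Agree (2 + ℓ) P s (glue U i (suc e)) e ⊎ Agree (2 + ℓ) P s (glue U j (suc f)) f)
    extend k s a b with in? c (period L) (2 + k) P s | win P s (2 + k) ≟ʷ mX | win P s (2 + k) ≟ʷ mY
    ... | yes p | _      | _      = inj₁ p
    ... | no ∉U | yes eq | _      = inj₂ (same-length₂ i e eq , inj₁ (window i e eq))
    ... | no ∉U | no ≢X  | yes eq = inj₂ (same-length₂ j f eq , inj₂ (window j f eq))
    ... | no ∉U | no ≢X  | no ≢Y  =
      contradiction (occ-win P s (2 + k)) (others (minimal-forbidden a b ∉U) ≢X ≢Y s)

    -- Windows grow from single letters by `extend`; the seams, of length `2 + ℓ`, are too long to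
    -- interfere.
    short-factor : ∀ k → k ≤ ℓ → ∀ s → In (1 + k) U P s
    short-factor zero    _   s = letter S P s
    short-factor (suc k) k<ℓ s with extend k s (short-factor k (<⇒≤ k<ℓ) s) (short-factor k (<⇒≤ k<ℓ) (suc s))
    ... | inj₁ p          = p
    ... | inj₂ (refl , _) = contradiction k<ℓ (<-irrefl refl)

    -- A window of length 1 + ℓ determines its position in U, and P can only leave the
    -- course of U through a seam, that is, at the end of a loop.
    follow : ∀ {s} → Agree (1 + ℓ) P s U i → ∀ r → r ≤ e → Agree (1 + ℓ) P (s + r) U (i + r)
    follow {s} a zero    _   = subst₂ (λ x y → Agree (1 + ℓ) P x U y) (sym (+-identityʳ s)) (sym (+-identityʳ i)) a
    follow {s} a (suc r) r<e = subst₂ (λ x y → Agree (1 + ℓ) P x U y) (sym (+-suc s r)) (sym (+-suc i r)) next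
      where
      here-agree : Agree (1 + ℓ) P (s + r) U (i + r)
      here-agree = follow a r (<⇒≤ r<e)
      next : Agree (1 + ℓ) P (suc (s + r)) U (suc (i + r))
      next with extend ℓ (s + r) (short-factor ℓ ≤-refl (s + r)) (short-factor ℓ ≤-refl (suc (s + r)))
      ... | inj₁ (x , b) = Agree-trans (Agree-sym (Agree-tail b))
        (Agree-tail (agree-cong c (period L) (injective (Agree-trans (Agree-init b) here-agree)) (2 + ℓ)))
      ... | inj₂ (_ , inj₁ eq) = contradiction
        (begin
          (i + suc r + (e ∸ r)) % c  ≡⟨ cong (_% c) (+-assoc i (suc r) (e ∸ r)) ⟩
          (i + suc (r + (e ∸ r))) % c ≡⟨ cong (λ z → (i + suc z) % c) (m+[n∸m]≡n (<⇒≤ r<e)) ⟩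
          (i + suc e) % c ≡⟨ cong (_% c) (+-suc i e) ⟩
          suc (i + e) % c ≡⟨ %-suc-cong c (injective (Agree-trans (Agree-sym (proj₁ (seam-agree S eq))) here-agree)) ⟩
          suc (i + r) % c ≡⟨ cong (_% c) (+-suc i r) ⟨
          (i + suc r) % c ∎)
        (%-shift c (i + suc r) (e ∸ r) (m<n⇒0<n∸m r<e) (≤-<-trans (m∸n≤m e r) (<-trans (n<1+n e) (loop-< S))))
        where open ≡-Reasoning
      ... | inj₂ (_ , inj₂ eq) = contradiction
        (begin
          (i + suc r) % c ≡⟨ cong (_% c) (+-suc i r) ⟩
          suc (i + r) % c ≡⟨ %-suc-cong c (injective (Agree-trans (Agree-sym here-agree) (proj₁ (seam-agree (swap S) eq)))) ⟩
          suc (j + f) % c ≡⟨ cong (_% c) (+-suc j f) ⟨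
          (j + suc f) % c ≡⟨ j→i ⟩
          i % c           ∎)
        (loop-step S r (<⇒≤ r<e))
        where open ≡-Reasoning

    -- After the seam `P` reads `U` from `i`. Following the loop for `d ≤ e` steps leads to `i + d`,
    -- while the period returns the window found at `i`, so `injective` would make the two
    -- congruent.
    seam-avoided : ∀ {d} .{{_ : NonZero d}} → d < suc e → Period d P → ∀ s → ¬ OccAt P mX s
    seam-avoided {suc d} d<1+e per s occ = loop-step S d (<⇒≤ (≤-pred d<1+e))
      (injective (Agree-trans (Agree-sym (follow a (suc d) (≤-pred d<1+e)))
        (Agree-trans (agree λ {r} _ → shift r) a)))
      where
      a : Agree (1 + ℓ) P (suc s) U i
      a = proj₂ (seam-agree S (occ-agree occ))
      shift : ∀ r → P (suc s + suc d + r) ≡ P (suc s + r)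
      shift r = trans (cong P (eq s d r)) (per (suc s + r))
        where
        eq : ∀ s d r → suc s + suc d + r ≡ suc s + r + suc d
        eq = solve-∀

  -- Removing one seam, then both.

  record Split : Set where
    field
      {V₁ V₂} : List Word
      {U₁ U₂} : Seq
      {c₁ c₂} : ℕ
      c-eq    : c ≡ c₁ + c₂
      <₁      : length V₁ < length V
      <₂      : length V₂ < length V₁
      least₁  : Least V₁ U₁ c₁
      least₂  : Least V₂ U₂ c₂
      nz₁     : NonZero c₁
      nz₂     : NonZero c₂

  -- The seam of the longer loop goes first. The closed loops satisfy the reduced systems; a word of
  -- smaller period contains no removed seam by `seam-avoided`, so it would satisfy all of `V`.
  loops-split : ∀ {ℓ i e j f} → Loops ℓ i e j f → e ≤ f → Split
  loops-split {ℓ} {i} {e} {j} {f} S e≤f = record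
    { V₁ = V₁ ; V₂ = V₂ ; c₁ = suc f ; c₂ = suc e
    ; c-eq = trans (sym length-eq) (+-comm (suc e) (suc f))
    ; <₁ = length-∖ (seam-∈ (swap S))
    ; <₂ = length-∖ (∈-∖⁺ (seam-∈ S) (seams-≢ S))
    ; least₁ = record
      { period = loop-period (swap S)
      ; sat = λ v∈ → let v∈V , v≢Y = ∈-∖⁻ v∈ in loop-avoids (swap S) v∈V v≢Y
      ; least = λ {d} {P} d<1+f per satP → least L (<-trans d<1+f (loop-< (swap S))) per
          (λ {v} → via-Y {P} d<1+f per satP)
      }
    ; least₂ = record
      { period = loop-period S
      ; sat = λ v∈ → let v∈V₁ , v≢X = ∈-∖⁻ v∈ in loop-avoids S (proj₁ (∈-∖⁻ {V} v∈V₁)) v≢X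
      ; least = λ {d} {P} d<1+e per satP → least L (<-trans d<1+e (loop-< S)) per
          (λ {v} → via-XY {P} d<1+e per satP)
      }
    ; nz₁ = _
    ; nz₂ = _
    }
    where
    open Loops S
    mX = seam U i e ℓ
    mY = seam U j f ℓ
    V₁ = V ∖ mY
    V₂ = V₁ ∖ mX
    via-Y : ∀ {P d} .{{_ : NonZero d}} → d < suc f → Period d P → Sat P V₁ → Sat P V
    via-Y d< per satP {v} v∈V with v ≟ʷ mY
    ... | yes refl = seam-avoided (swap S) (λ v∈V v≢Y _ → satP (∈-∖⁺ v∈V v≢Y)) d< per
    ... | no v≢Y   = satP (∈-∖⁺ v∈V v≢Y)
    via-XY : ∀ {P d} .{{_ : NonZero d}} → d < suc e → Period d P → Sat P V₂ → Sat P V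
    via-XY d< per satP {v} v∈V with v ≟ʷ mX | v ≟ʷ mY
    ... | yes refl | _        = seam-avoided S (λ v∈V v≢X v≢Y → satP (∈-∖⁺ (∈-∖⁺ v∈V v≢Y) v≢X)) d< per
    -- Here the order of removal matters: `d < suc e ≤ suc f` excludes the longer loop's seam too.
    ... | no _     | yes refl = seam-avoided (swap S) (λ v∈V v≢Y v≢X → satP (∈-∖⁺ (∈-∖⁺ v∈V v≢Y) v≢X))
                                  (<-≤-trans d< (s≤s e≤f)) per
    ... | no v≢X   | no v≢Y   = satP (∈-∖⁺ (∈-∖⁺ v∈V v≢Y) v≢X)

  -- Existence of a longest repeated word.

  Repeats : ℕ → Set
  Repeats ℓ = ∃ λ j → j < c × ∃ λ i → i < j × Agree ℓ U i U j

  repeats? : ∀ ℓ → Dec (Repeats ℓ)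
  repeats? ℓ = anyUpTo? (λ j → anyUpTo? (λ i → agree? ℓ U i U j) j) c

  -- Closing up along a word of length `ℓ` creates only new factors of length at least `2 + ℓ`,
  -- longer than every prohibition.
  repeats-bounded : ¬ Repeats (max 0 (map length V))
  repeats-bounded (j , j<c , i , i<j , a) = least L 1+e<c (glue-period a′) avoids
    where
    ℓ = max 0 (map length V)
    e = j ∸ suc i
    i+1+e≡j : i + suc e ≡ j
    i+1+e≡j = trans (+-suc i e) (m+[n∸m]≡n i<j)
    1+e<c : suc e < c
    1+e<c = ≤-<-trans (subst (suc e ≤_) i+1+e≡j (m≤n+m (suc e) i)) j<c
    a′ : Agree ℓ U i U (i + suc e)
    a′ = subst (Agree ℓ U i U) (sym i+1+e≡j) a
    avoids : Sat (glue U i (suc e)) V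
    avoids {v} v∈V t occ with glue-factor a′ t (length v)
    ... | inj₁ (x , b)      = sat L v∈V x (Agree-trans b occ)
    ... | inj₂ (o , le , _) = <⇒≱ (m≤n+m (suc ℓ) 1)
      (≤-trans (m+n≤o⇒n≤o o le) (All-lookup (xs≤max 0 (map length V)) (∈-map⁺ length v∈V)))

  longest-repeat : ∀ {ℓ i j} → j < c → i < j → Agree ℓ U i U j → ¬ Repeats (suc ℓ) → ∃ λ e → ∃ λ f → Loops ℓ i e j f
  longest-repeat {ℓ} {i} {j} j<c i<j a ¬rep = e , f , record
    { length-eq = length-eq
    ; i→j = cong (_% c) i+1+e≡j
    ; j→i = begin
        (j + suc f) % c         ≡⟨ cong (λ z → (z + suc f) % c) i+1+e≡j ⟨
        (i + suc e + suc f) % c ≡⟨ cong (_% c) (+-assoc i (suc e) (suc f)) ⟩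
        (i + (suc e + suc f)) % c ≡⟨ cong (λ z → (i + z) % c) length-eq ⟩
        (i + c) % c             ≡⟨ [m+n]%n≡m%n i c ⟩
        i % c                   ∎
    ; shared = a
    ; injective = injective
    }
    where
    open ≡-Reasoning
    e = j ∸ suc i
    f = c ∸ suc (suc e)
    i+1+e≡j : i + suc e ≡ j
    i+1+e≡j = trans (+-suc i e) (m+[n∸m]≡n i<j)
    length-eq : suc e + suc f ≡ c
    length-eq = trans (+-suc (suc e) f)
      (m+[n∸m]≡n (≤-<-trans (subst (suc e ≤_) i+1+e≡j (m≤n+m (suc e) i)) j<c))
    residues : ∀ {x y} → Agree (1 + ℓ) U x U y → Agree (1 + ℓ) U (x % c) U (y % c)
    residues {x} {y} b = Agree-trans (agree-cong c (period L) (m%n%n≡m%n x c) (1 + ℓ))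
      (Agree-trans b (agree-cong c (period L) (sym (m%n%n≡m%n y c)) (1 + ℓ)))
    injective : ∀ {x y} → Agree (1 + ℓ) U x U y → x % c ≡ y % c
    injective {x} {y} b with <-cmp (x % c) (y % c)
    ... | tri< lt _ _ = contradiction (y % c , m%n<n y c , x % c , lt , residues b) ¬rep
    ... | tri≈ _ eq _ = eq
    ... | tri> _ _ gt = contradiction (x % c , m%n<n x c , y % c , gt , Agree-sym (residues b)) ¬rep

  -- For `c > 1` the empty word repeats at `0` and `1`, so below the bound of `repeats-bounded`
  -- there is a last length that repeats.
  split : 1 < c → Split
  split 1<c
    with ℓ , (j , j<c , i , i<j , a) , ¬rep ←
           last-true repeats? (1 , 1<c , 0 , s≤s z≤n , agree λ ()) _ repeats-bounded
    with e , f , S ← longest-repeat j<c i<j a ¬rep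
    with ≤-total e f
  ... | inj₁ e≤f = loops-split S e≤f
  ... | inj₂ f≤e = loops-split (swap S) f≤e

-- The Fibonacci bound.

1≤F : ∀ n → 1 ≤ F n
1≤F 0             = ≤-refl
1≤F 1             = ≤-refl
1≤F (suc (suc n)) = ≤-trans (1≤F (suc n)) (m≤m+n _ (F n))

-- The induction is on a bound `n` for the length, because removing a word may shorten the list by
-- more than one.
least-period-≤-F : ∀ n {V U c} .{{_ : NonZero c}} → length V ≤ n → Least V U c → c ≤ F n
least-period-≤-F n {V} {U} {c} len L with c ≤? 1
... | yes c≤1 = ≤-trans c≤1 (1≤F n)
... | no  c≰1
  with V̂ , len̂ , sat̂ , minimal , reflects ← minimise (period L) V (sat L)
  = go n (subst (_≤ n) (sym len̂) len) (split L̂ minimal (≰⇒> c≰1))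
  where
  L̂ : Least V̂ U c
  L̂ = record { period = period L ; sat = sat̂ ; least = λ d<c per satP → least L d<c per (reflects satP) }
  go : ∀ n → length V̂ ≤ n → Split L̂ minimal → c ≤ F n
  go zero          len S = contradiction (≤-trans (Split.<₁ S) len) λ ()
  go (suc zero)    len S = contradiction (≤-trans (s≤s (Split.<₂ S)) (≤-trans (Split.<₁ S) len)) λ { (s≤s ()) }
  go (suc (suc n)) len S = subst (_≤ F (suc (suc n))) (sym c-eq)
    (+-mono-≤ (least-period-≤-F (suc n) {{nz₁}} len₁ least₁)
              (least-period-≤-F n {{nz₂}} (≤-pred (≤-trans <₂ len₁)) least₂))
    where
    open Split S
    len₁ : length V₁ ≤ suc n
    len₁ = ≤-pred (≤-trans <₁ len)

-- Two-sided words and powers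

-- The two numbers differ by `q₂ - q₁` times `d`; the sign of this factor decides to which side the
-- multiple is added in `ℕ`.
%ℕ-+ : ∀ d .{{_ : NonZero d}} z r → (z ℤ.+ ℤ.+ r) %ℕ d ≡ (z %ℕ d + r) % d
%ℕ-+ d z r = trans (sym (m<n⇒m%n≡m (n%ℕd<d (z ℤ.+ ℤ.+ r) d))) (unique (q₂ ℤ.- q₁) difference)
  where
  open +-*-Solver
  q₁ = (z ℤ.+ ℤ.+ r) ℤ./ℕ d
  q₂ = z ℤ./ℕ d
  unique : ∀ {a b} k → ℤ.+ a ≡ ℤ.+ b ℤ.+ k ℤ.* ℤ.+ d → a % d ≡ b % d
  unique {a} {b} (ℤ.+ n) eq = trans (cong (_% d) (ℤₚ.+-injective (trans eq
    (cong (λ x → ℤ.+ b ℤ.+ x) (sym (ℤₚ.pos-* n d)))))) ([m+kn]%n≡m%n b n d)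
  unique {a} {b} ℤ.-[1+ n ] eq = trans (sym ([m+kn]%n≡m%n a (suc n) d)) (cong (_% d) (ℤₚ.+-injective (begin
    ℤ.+ a ℤ.+ ℤ.+ (suc n * d) ≡⟨ cong₂ ℤ._+_ eq (ℤₚ.pos-* (suc n) d) ⟩
    ℤ.+ b ℤ.+ (ℤ.- N) ℤ.* ℤ.+ d ℤ.+ N ℤ.* ℤ.+ d
      ≡⟨ solve 3 (λ b n d → b :+ (:- n) :* d :+ n :* d := b) refl (ℤ.+ b) N (ℤ.+ d) ⟩
    ℤ.+ b ∎)))
    where
    open ≡-Reasoning
    N = ℤ.+ suc n
  difference : ℤ.+ ((z ℤ.+ ℤ.+ r) %ℕ d) ≡ ℤ.+ (z %ℕ d + r) ℤ.+ (q₂ ℤ.- q₁) ℤ.* ℤ.+ d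
  difference = begin
    A                                        ≡⟨ solve 3 (λ a q d → a := a :+ q :* d :- q :* d) refl A q₁ D ⟩
    A ℤ.+ q₁ ℤ.* D ℤ.- q₁ ℤ.* D              ≡⟨ cong (λ x → x ℤ.- q₁ ℤ.* D) (a≡a%ℕn+[a/ℕn]*n (z ℤ.+ ℤ.+ r) d) ⟨
    z ℤ.+ ℤ.+ r ℤ.- q₁ ℤ.* D                 ≡⟨ cong (λ x → x ℤ.+ ℤ.+ r ℤ.- q₁ ℤ.* D) (a≡a%ℕn+[a/ℕn]*n z d) ⟩
    B ℤ.+ q₂ ℤ.* D ℤ.+ ℤ.+ r ℤ.- q₁ ℤ.* D    ≡⟨ solve 5 (λ b r p q d → b :+ p :* d :+ r :- q :* d := b :+ r :+ (p :- q) :* d)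
                                                  refl B (ℤ.+ r) q₂ q₁ D ⟩
    B ℤ.+ ℤ.+ r ℤ.+ (q₂ ℤ.- q₁) ℤ.* D        ∎
    where
    open ≡-Reasoning
    A = ℤ.+ ((z ℤ.+ ℤ.+ r) %ℕ d)
    B = ℤ.+ (z %ℕ d)
    D = ℤ.+ d

lookup-nth : ∀ (v : Word) k → lookup v k ≡ nth v (toℕ k)
lookup-nth (x ∷ v) Fin.zero    = refl
lookup-nth (x ∷ v) (Fin.suc k) = lookup-nth v k

applyUpTo-+ : ∀ (f : Seq) a b → applyUpTo f (a + b) ≡ applyUpTo f a ++ applyUpTo (λ r → f (a + r)) b
applyUpTo-+ f zero    b = refl
applyUpTo-+ f (suc a) b = cong (f 0 ∷_) (applyUpTo-+ (f ∘ suc) a b)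

win-power : ∀ {g U} → Period g U → ∀ m → win U 0 (m * g) ≡ concat (replicate m (win U 0 g))
win-power         per zero    = refl
win-power {g} {U} per (suc m) = begin
  win U 0 (g + m * g)                       ≡⟨ applyUpTo-+ U g (m * g) ⟩
  win U 0 g ++ win U g (m * g)              ≡⟨ cong (win U 0 g ++_) (win-cong shift) ⟩
  win U 0 g ++ win U 0 (m * g)              ≡⟨ cong (win U 0 g ++_) (win-power per m) ⟩
  win U 0 g ++ concat (replicate m (win U 0 g)) ∎
  where
  open ≡-Reasoning
  shift : Agree (m * g) U g U 0
  shift = agree λ {r} _ → trans (cong U (+-comm g r)) (per r)

-- The Bézout identity turns a shift by `g` into shifts by multiples of `c` and `d`.
period-gcd : ∀ {c d U} .{{_ : NonZero c}} .{{_ : NonZero d}} → Period c U → Period d U →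
  ∃ λ g → g ∣ c × g ∣ d × Period g U
period-gcd {c} {d} {U} perc perd with Bézout.lemma c d
... | Bézout.result g isGCD identity = g , proj₁ (GCD.commonDivisor isGCD) , proj₂ (GCD.commonDivisor isGCD) , perg identity
  where
  perg′ : ∀ {c d x y} .{{_ : NonZero c}} .{{_ : NonZero d}} → Period c U → Period d U → g + y * d ≡ x * c → Period g U
  perg′ {c} {d} {x} {y} perc perd eq n = begin
    U (n + g)           ≡⟨ period-* d perd y (n + g) ⟨
    U (n + g + y * d)   ≡⟨ cong U (+-assoc n g (y * d)) ⟩
    U (n + (g + y * d)) ≡⟨ cong (λ z → U (n + z)) eq ⟩
    U (n + x * c)       ≡⟨ period-* c perc x n ⟩
    U n                 ∎
    where open ≡-Reasoning
  perg : Bézout.Identity g c d → Period g U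
  perg (Bézout.+- x y eq) = perg′ {c} {d} {x} {y} perc perd eq
  perg (Bézout.-+ x y eq) = perg′ {d} {c} {y} {x} perd perc eq

module _ (x : X) (xs : Word) where

  private
    u = x ∷ xs
    c = length u
    U : Seq
    U n = per u (ℤ.+ n)

  per-nth : ∀ z → per u z ≡ nth u (z %ℕ c)
  per-nth z = trans (lookup-nth u (fromℕ< (n%ℕd<d z c))) (cong (nth u) (toℕ-fromℕ< (n%ℕd<d z c)))

  per-period : Period c U
  per-period n = begin
    U (n + c)          ≡⟨ per-nth (ℤ.+ (n + c)) ⟩
    nth u ((n + c) % c) ≡⟨ cong (nth u) ([m+n]%n≡m%n n c) ⟩
    nth u (n % c)      ≡⟨ per-nth (ℤ.+ n) ⟨
    U n                ∎
    where open ≡-Reasoning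

  per-win : u ≡ win U 0 c
  per-win = ≡-win u U 0 refl (agree λ {r} r<c → trans (cong (nth u) (sym (m<n⇒m%n≡m r<c))) (sym (per-nth (ℤ.+ r))))

  -- `d` need not divide `c`, but the gcd `g` does, and `g ≤ d < c` makes the exponent at least two.
  short-period⇒periodic : ∀ {d} .{{_ : NonZero d}} → d < c → Period d U → Periodic u
  short-period⇒periodic {d} d<c perd with period-gcd per-period perd
  ... | g , divides m eq , g∣d , perg = win U 0 g , m , 2≤m m eq , (begin
    u                              ≡⟨ per-win ⟩
    win U 0 c                      ≡⟨ cong (win U 0) eq ⟩
    win U 0 (m * g)                ≡⟨ win-power perg m ⟩
    concat (replicate m (win U 0 g)) ∎)
    where
    open ≡-Reasoning
    2≤m : ∀ m → c ≡ m * g → 2 ≤ m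
    2≤m (suc zero)    eq = contradiction d<c (≤⇒≯ (≤-trans (≤-reflexive (trans eq (+-identityʳ g))) (∣⇒≤ g∣d)))
    2≤m (suc (suc m)) _  = s≤s (s≤s z≤n)

  -- A word of period `d < c` satisfying `V` extends to a two-sided one. By uniqueness that is a
  -- shift of `per u`, which then has period `d`, so `u` would be periodic.
  defines⇒least : ∀ {V} → ¬ Periodic u → Defines V (per u) → Least V U c
  defines⇒least {V} ¬periodic (satisfies , unique) = record
    { period = per-period
    ; sat = λ {v} v∈V s occ → satisfies v v∈V (ℤ.+ s , λ k → trans (occ at toℕ<n k) (sym (lookup-nth v k)))
    ; least = λ {d} {P} d<c per satP → ¬periodic (short-period⇒periodic d<c (period-of-shift {d} {P} per satP))
    }
    where
    period-of-shift : ∀ {d P} .{{_ : NonZero d}} → Period d P → Sat P V → Period d U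
    period-of-shift {d} {P} perP satP n = begin
      per u (ℤ.+ (n + d))            ≡⟨ cong (per u) (eq (ℤ.+ n) (ℤ.+ d)) ⟩
      per u (z ℤ.+ ℤ.+ d ℤ.+ k)      ≡⟨ shift (z ℤ.+ ℤ.+ d) ⟨
      P ((z ℤ.+ ℤ.+ d) %ℕ d)         ≡⟨ W-+ z d ⟩
      P (z %ℕ d + d)                 ≡⟨ perP (z %ℕ d) ⟩
      P (z %ℕ d)                     ≡⟨ shift z ⟩
      per u (z ℤ.+ k)                ≡⟨ cong (per u) (eq′ (ℤ.+ n)) ⟩
      per u (ℤ.+ n)                  ∎
      where
      open ≡-Reasoning
      W : BiWord
      W z = P (z %ℕ d)
      W-+ : ∀ z r → W (z ℤ.+ ℤ.+ r) ≡ P (z %ℕ d + r)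
      W-+ z r = trans (cong P (%ℕ-+ d z r)) (period-% d perP (z %ℕ d + r))
      satW : Satisfies W V
      satW v v∈V (z , occ) = satP v∈V (z %ℕ d) (agree λ {r} r<∣v∣ → begin
        P (z %ℕ d + r)                            ≡⟨ W-+ z r ⟨
        W (z ℤ.+ ℤ.+ r)                           ≡⟨ cong (λ r → W (z ℤ.+ ℤ.+ r)) (toℕ-fromℕ< r<∣v∣) ⟨
        W (z ℤ.+ ℤ.+ toℕ (fromℕ< r<∣v∣))          ≡⟨ occ (fromℕ< r<∣v∣) ⟩
        lookup v (fromℕ< r<∣v∣)                   ≡⟨ lookup-nth v (fromℕ< r<∣v∣) ⟩
        nth v (toℕ (fromℕ< r<∣v∣))                ≡⟨ cong (nth v) (toℕ-fromℕ< r<∣v∣) ⟩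
        nth v r                                   ∎)
      k = proj₁ (unique W satW)
      shift = proj₂ (unique W satW)
      -- The position that the shift by `k` sends to `n`.
      z = ℤ.+ n ℤ.- k
      open +-*-Solver
      eq : ∀ n d → n ℤ.+ d ≡ n ℤ.- k ℤ.+ d ℤ.+ k
      eq n d = solve 3 (λ n d k → n :+ d := n :- k :+ d :+ k) refl n d k
      eq′ : ∀ n → n ℤ.- k ℤ.+ k ≡ n
      eq′ n = solve 2 (λ n k → n :- k :+ k := n) refl n k

theorem2p5 : (V : List Word) → Unique V → (u : Word) → u ≢ [] → ¬ Periodic u →
    Defines V (per u) → length u ≤ F (length V)
theorem2p5 V _ []       u≢[] _         _       = contradiction refl u≢[]
theorem2p5 V _ (x ∷ xs) _    ¬periodic defines =
  least-period-≤-F (length V) ≤-refl (defines⇒least x xs ¬periodic defines)
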